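{- For any integer $k\geq 1$ and real $\epsilon>0$, there is an integer $n=n(k,\epsilon)$ such that the following holds. Suppose $G$ is a finite group and $A\subseteq G$ is $k$-stable. Then there is a normal subgroup $H\leq G$, of index at most $n$, such that for each coset $C$ of $H$ in $G$, either $|C\cap A|\leq\epsilon|H|$ or $|C\setminus A|\leq \epsilon|H|$.
   Context: Given a group $G$, a subset $A\subseteq G$ and an integer $k\geq 1$, $A$ is called $k$-stable if there do not exist $a_1,\ldots,a_k,b_1,\ldots,b_k\in G$ such that, for all $i,j\in\{1,\ldots,k\}$, $a_ib_j\in A$ if and only if $i\leq j$. -}

module Defs where

open import Data.Nat as ℕ using (ℕ)
open import Data.Integer as ℤ using (ℤ)
open import Data.Fin using (Fin) renaming (_≤_ to _≤ᶠ_)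
open import Data.Fin.Subset using (Subset; _∈_; _∉_)
open import Data.Vec using (tabulate; lookup)
open import Data.Product using (Σ; _×_)
open import Relation.Nullary using (¬_)
open import Relation.Binary.PropositionalEquality using (_≡_)
open import Algebra.Structures using (IsGroup)
open import Data.Rational using (ℚ; _/_)
open import Data.Bool using (Bool)
open import Function.Bundles using (_⇔_)

-- A finite group: carrier Fin order (every finite group is isomorphic to one of these),
-- with the standard-library group laws w.r.t. propositional equality.
record FinGroup : Set where
  field
    order   : ℕ
    _∙_     : Fin order → Fin order → Fin order
    e       : Fin order
    _⁻¹     : Fin order → Fin order
    isGroup : IsGroup _≡_ _∙_ e _⁻¹

module _ (G : FinGroup) where
  open FinGroup G

  Stable : ℕ → Subset order → Set
  Stable k A = ¬ (Σ (Fin k → Fin order) λ a → Σ (Fin k → Fin order) λ b →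
                   ∀ (i j : Fin k) → ((a i ∙ b j) ∈ A) ⇔ (i ≤ᶠ j))

  record IsNormalSubgroup (H : Subset order) : Set where
    field
      e∈H   : e ∈ H
      ∙-closed : ∀ {x y} → x ∈ H → y ∈ H → (x ∙ y) ∈ H
      ⁻¹-closed : ∀ {x} → x ∈ H → (x ⁻¹) ∈ H
      conj-closed : ∀ g {h} → h ∈ H → ((g ∙ h) ∙ (g ⁻¹)) ∈ H

  coset : Fin order → Subset order → Subset order
  coset g H = tabulate λ x → lookup H ((g ⁻¹) ∙ x)

toℚ : ℕ → ℚ
toℚ n = ℤ.+ n / 1

{-# OPTIONS --safe #-}

-- Let d(x, z) be the number of y on which x⁻¹A and z⁻¹A differ; d is a right-invariant pseudometric. A high
-- Shelah tree for the relation x ∙ y ∈ A contains a half-graph of length k, so for stable A all trees are low.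
-- This is used twice. First, elements whose distances to e decrease rapidly generate a tree, so at some scale P,
-- bounded in terms of k and ε, every x with d(x, e) ≤ |G| / P even satisfies d(x, e) ≤ |G| / F, with F as large
-- as desired in terms of P; these x then form a subgroup. Second, many points at pairwise distance > |G| / P
-- carry a tree, so the index of this subgroup, and hence that of its normal core K, is bounded in terms of P
-- and k. If a coset of K met both A and its complement in more than ε|K| points, then averaging over h ∈ K
-- would produce an h with d(h, e) > |G| / F.
module Submission where

open import Defs
open import Algebra.Bundles using (Group)
import Algebra.Properties.Group as GroupProperties
open import Algebra.Structures using (IsGroup)
import Algebra.Properties.Semiring.Sum as SemiringSum
open import Data.Bool using (Bool; true; false; not; _∧_; _∨_; _xor_)
open import Data.Bool.Properties using (xor-comm; xor-identityʳ; xor-same) renaming (_≟_ to _≟ᵇ_)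
open import Data.Fin using (Fin; zero; suc; toℕ; opposite; inject₁; funToFin; finToFun) renaming (_≤_ to _≤ᶠ_; _<_ to _<ᶠ_)
open import Data.Fin.Permutation using (Permutation′; permutation; _⟨$⟩ʳ_)
open import Data.Fin.Properties using (any?; all?; opposite-prop; toℕ-inject₁; toℕ<n; finToFun-funToFin) renaming (_≟_ to _≟ᶠ_)
open import Data.Fin.Subset using (Subset; _∈_; _∩_; ∁; ∣_∣)
import Data.Integer as ℤ
import Data.Integer.Properties as ℤ
open import Data.List as List using (List; []; _∷_; length; filter; allFin)
open import Data.List.Membership.Propositional using () renaming (_∈_ to _∈ᴸ_)
open import Data.List.Membership.Propositional.Properties using (∈-filter⁻; ∈-allFin)
open import Data.List.Relation.Unary.All using ([]; _∷_)
open import Data.List.Relation.Unary.All.Properties using (¬Any⇒All¬)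
open import Data.List.Relation.Unary.AllPairs using (AllPairs; []; _∷_)
import Data.List.Relation.Unary.AllPairs.Properties as AllPairs
open import Data.List.Relation.Unary.Any as Any using (Any; here; there)
open import Data.List.Relation.Unary.Any.Properties using (lookup-index)
open import Data.Nat using (ℕ; zero; suc; _+_; _*_; _^_; _≤_; _<_; z≤n; s≤s; NonZero; >-nonZero; >-nonZero⁻¹)
open import Data.Nat.ListAction using () renaming (sum to sumᴸ)
open import Data.Nat.Properties
open import Data.Nat.Tactic.RingSolver using (solve-∀)
open import Data.Product using (Σ; _×_; _,_; proj₁; proj₂)
open import Data.Rational as ℚ using (ℚ; mkℚ; 0ℚ; toℚᵘ) renaming (_<_ to _<ℚ_; _≤_ to _≤ℚ_; _*_ to _*ℚ_)
import Data.Rational.Properties as ℚ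
open import Data.Rational.Unnormalised as ℚᵘ using (mkℚᵘ; *≤*)
import Data.Rational.Unnormalised.Properties as ℚᵘ
open import Data.Sum as Sum using (_⊎_; inj₁; inj₂; [_,_]′)
open import Data.Unit using (⊤; tt)
open import Data.Vec using ([]; _∷_; lookup; tabulate)
open import Data.Vec.Functional using () renaming (_∷_ to _∷ᶠ_)
open import Data.Vec.Properties using (lookup∘tabulate; []=⇒lookup; lookup⇒[]=; lookup-zipWith; lookup-map)
open import Function using (_∘_; id; mk⇔; case_of_)
open import Level using (0ℓ)
open import Relation.Binary.PropositionalEquality
open import Relation.Nullary using (¬_; Dec; yes; no; does; contradiction)
open import Relation.Nullary.Decidable using (dec-true; ¬?; _×-dec_; decidable-stable)
open import Relation.Unary using (Pred)

open SemiringSum +-*-semiring using (sum; sum-cong-≗; sum-permute; ∑-distrib-+; ∑-comm; *-distribˡ-sum; *-distribʳ-sum)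

-- Finite sums and counting

sum-mono : ∀ {n} {f g : Fin n → ℕ} → (∀ i → f i ≤ g i) → sum f ≤ sum g
sum-mono {zero}  f≤g = z≤n
sum-mono {suc n} f≤g = +-mono-≤ (f≤g zero) (sum-mono (f≤g ∘ suc))

sum-bound : ∀ {n c} {f : Fin n → ℕ} → (∀ i → f i ≤ c) → sum f ≤ n * c
sum-bound {zero}  f≤c = z≤n
sum-bound {suc n} f≤c = +-mono-≤ (f≤c zero) (sum-bound (f≤c ∘ suc))

𝟙 : Bool → ℕ
𝟙 true  = 1
𝟙 false = 0

𝟙-mono : ∀ {b c} → (b ≡ true → c ≡ true) → 𝟙 b ≤ 𝟙 c
𝟙-mono {false} b⇒c = z≤n
𝟙-mono {true}  b⇒c rewrite b⇒c refl = ≤-refl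

# : ∀ {n} → (Fin n → Bool) → ℕ
# p = sum (𝟙 ∘ p)

#-cong : ∀ {n} {p q : Fin n → Bool} → (∀ i → p i ≡ q i) → # p ≡ # q
#-cong p≗q = sum-cong-≗ (cong 𝟙 ∘ p≗q)

#-mono : ∀ {n} {p q : Fin n → Bool} → (∀ i → p i ≡ true → q i ≡ true) → # p ≤ # q
#-mono p⇒q = sum-mono λ i → 𝟙-mono (p⇒q i)

#-permute : ∀ {n} (p : Fin n → Bool) (π : Permutation′ n) → # (p ∘ (π ⟨$⟩ʳ_)) ≡ # p
#-permute p π = sym (sum-permute (𝟙 ∘ p) π)

#-none : ∀ n → # {n} (λ _ → false) ≡ 0
#-none zero    = refl
#-none (suc n) = #-none n

#-subset : ∀ {n} (S : Subset n) → ∣ S ∣ ≡ # (lookup S)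
#-subset []          = refl
#-subset (true  ∷ S) = cong suc (#-subset S)
#-subset (false ∷ S) = #-subset S

#-witness : ∀ {n} (p q : Fin n → Bool) → # p < # q → Σ (Fin n) λ i → q i ≡ true × p i ≡ false
#-witness p q p<q with any? (λ i → 𝟙 (p i) <? 𝟙 (q i))
... | yes (i , lt) = i , split (p i) (q i) lt
  where
  split : ∀ b c → 𝟙 b < 𝟙 c → c ≡ true × b ≡ false
  split false true  _ = refl , refl
  split true  true  (s≤s ())
... | no none = contradiction (sum-mono λ i → ≮⇒≥ λ lt → none (i , lt)) (<⇒≱ p<q)

#-positive : ∀ {n} (p : Fin n → Bool) i → p i ≡ true → 1 ≤ # p
#-positive p zero    eq rewrite eq = s≤s z≤n
#-positive p (suc i) eq = m≤n⇒m≤o+n (𝟙 (p zero)) (#-positive (p ∘ suc) i eq)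

-- Double counting: every `i` is counted in the fibre over `f i`.
preimage-bound : ∀ {a b} (f : Fin a → Fin b) (c : ℕ) →
  (∀ j → # (λ i → does (f i ≟ᶠ j)) ≤ c) → a ≤ b * c
preimage-bound {a} {b} f c fibre = begin
  a                                             ≡⟨ *-identityʳ a ⟨
  a * 1                                         ≡⟨ sum-const a ⟨
  sum {a} (λ _ → 1)                             ≤⟨ sum-mono (λ i → hit (f i)) ⟩
  sum (λ i → sum (λ j → 𝟙 (does (f i ≟ᶠ j))))   ≡⟨ ∑-comm (λ i j → 𝟙 (does (f i ≟ᶠ j))) ⟩
  sum (λ j → # (λ i → does (f i ≟ᶠ j)))         ≤⟨ sum-bound fibre ⟩
  b * c                                         ∎
  where
  open ≤-Reasoning
  sum-const : ∀ n → sum {n} (λ _ → 1) ≡ n * 1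
  sum-const zero = refl
  sum-const (suc n) = cong suc (sum-const n)
  hit : ∀ j → 1 ≤ # (λ j′ → does (j ≟ᶠ j′))
  hit j = #-positive _ j (dec-true (j ≟ᶠ j) refl)

-- Trees and half-graphs

-- A Ramsey-type recursion: the two summands are the heights handed to `colour`, and the extra one
-- in each is the root spent on a new rung.
height : ℕ → ℕ → ℕ
height zero    r       = 0
height (suc l) zero    = 0
height (suc l) (suc r) = suc (height l (suc r)) + suc (height (suc l) r)

module Trees {X Y : Set} (R : X → Y → Bool) where

  -- Internal nodes lie in Q and split the leaves, which lie in P; Q is not refined along the way.
  Tree : ℕ → Pred X 0ℓ → Pred Y 0ℓ → Set
  Tree zero    P Q = Σ X P
  Tree (suc n) P Q = Σ Y λ y → Q y × (∀ s → Tree n (λ x → P x × R x y ≡ s) Q)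

  Tree-mono : ∀ n {P P′ : Pred X 0ℓ} {Q Q′ : Pred Y 0ℓ} →
    (∀ {x} → P x → P′ x) → (∀ {y} → Q y → Q′ y) → Tree n P Q → Tree n P′ Q′
  Tree-mono zero    f g (x , px)        = x , f px
  Tree-mono (suc n) f g (y , qy , kids) =
    y , g qy , λ s → Tree-mono n (λ (px , eq) → f px , eq) g (kids s)

  leaf : ∀ n {P : Pred X 0ℓ} {Q : Pred Y 0ℓ} → Tree n P Q → Σ X P
  leaf zero    t              = t
  leaf (suc n) (y , _ , kids) with x , px , _ ← leaf n (kids true) = x , px

  -- If both children contain a tree in the colour of the root, the root joins them; otherwise one
  -- child already has a tree of full height in the other colour. At height zero any leaf will do,
  -- as there are no nodes to colour.
  colour : (c : Y → Bool) → ∀ m n {P : Pred X 0ℓ} {Q : Pred Y 0ℓ} → Tree (m + n) P Q →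
    Tree m P (λ y → Q y × c y ≡ true) ⊎ Tree n P (λ y → Q y × c y ≡ false)
  colour c zero    n       t = inj₁ (leaf n t)
  colour c (suc m) zero    t = inj₂ (leaf (suc m + 0) t)
  colour c (suc m) (suc n) {P} {Q} (y , qy , kids) with c y in eq
  ... | true with colour c m (suc n) (kids true) | colour c m (suc n) (kids false)
  ...   | inj₂ t | _      = inj₂ (Tree-mono (suc n) proj₁ id t)
  ...   | inj₁ _ | inj₂ t = inj₂ (Tree-mono (suc n) proj₁ id t)
  ...   | inj₁ t | inj₁ u = inj₁ (y , (qy , eq) , λ { true → t ; false → u })
  colour c (suc m) (suc n) {P} {Q} (y , qy , kids) | false
    with colour c (suc m) n (shift true) | colour c (suc m) n (shift false)
    where
    shift : ∀ s → Tree (suc m + n) (λ x → P x × R x y ≡ s) Q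
    shift s = subst (λ h → Tree h (λ x → P x × R x y ≡ s) Q) (+-suc m n) (kids s)
  ...   | inj₁ t | _      = inj₁ (Tree-mono (suc m) proj₁ id t)
  ...   | inj₂ _ | inj₁ t = inj₁ (Tree-mono (suc m) proj₁ id t)
  ...   | inj₂ t | inj₂ u = inj₂ (y , (qy , eq) , λ { true → t ; false → u })

  -- `Ladder true` is the half-graph that stability forbids, `Ladder false` its complement; the sign
  -- lets `tree⇒ladder` treat both colours alike.
  record Ladder (s : Bool) (k : ℕ) (P : Pred X 0ℓ) (Q : Pred Y 0ℓ) : Set where
    field
      a     : Fin k → X
      b     : Fin k → Y
      a∈P   : ∀ i → P (a i)
      b∈Q   : ∀ j → Q (b j)
      above : ∀ i j → i ≤ᶠ j → R (a i) (b j) ≡ s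
      below : ∀ i j → j <ᶠ i → R (a i) (b j) ≡ not s
  open Ladder

  Ladder-[] : ∀ {s P Q} → Ladder s 0 P Q
  Ladder-[] = record { a = λ () ; b = λ () ; a∈P = λ () ; b∈Q = λ () ; above = λ () ; below = λ () }

  Ladder-mono : ∀ {s k} {P P′ : Pred X 0ℓ} {Q Q′ : Pred Y 0ℓ} →
    (∀ {x} → P x → P′ x) → (∀ {y} → Q y → Q′ y) → Ladder s k P Q → Ladder s k P′ Q′
  Ladder-mono f g L = record
    { a = a L ; b = b L ; a∈P = f ∘ a∈P L ; b∈Q = g ∘ b∈Q L ; above = above L ; below = below L }

  Ladder-∷ : ∀ {s k} {P : Pred X 0ℓ} {Q : Pred Y 0ℓ} {x y} → P x → Q y → R x y ≡ s →
    Ladder s k (λ x′ → P x′ × R x′ y ≡ not s) (λ y′ → Q y′ × R x y′ ≡ s) → Ladder s (suc k) P Q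
  Ladder-∷ {x = x} {y} px qy rxy L = record
    { a     = x ∷ᶠ a L
    ; b     = y ∷ᶠ b L
    ; a∈P   = λ { zero → px ; (suc i) → proj₁ (a∈P L i) }
    ; b∈Q   = λ { zero → qy ; (suc j) → proj₁ (b∈Q L j) }
    ; above = λ { zero zero _ → rxy ; zero (suc j) _ → proj₂ (b∈Q L j) ; (suc i) (suc j) (s≤s i≤j) → above L i j i≤j }
    ; below = λ { (suc i) zero _ → proj₂ (a∈P L i) ; (suc i) (suc j) (s≤s j<i) → below L i j j<i }
    }

  -- Colour the nodes by their relation to one leaf x: the root of a monochromatic subtree pairs with x, and
  -- the child on the side opposite to that colour continues the ladder.
  tree⇒ladder : ∀ l r {P : Pred X 0ℓ} {Q : Pred Y 0ℓ} → Tree (height l r) P Q →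
    Ladder true l P Q ⊎ Ladder false r P Q
  tree⇒ladder zero    r       t = inj₁ Ladder-[]
  tree⇒ladder (suc l) zero    t = inj₂ Ladder-[]
  tree⇒ladder (suc l) (suc r) {P} {Q} t =
    [ positive , negative ]′ (colour (R x) (suc (height l (suc r))) (suc (height (suc l) r)) t)
    where
    x : X
    x = proj₁ (leaf (height (suc l) (suc r)) t)
    px : P x
    px = proj₂ (leaf (height (suc l) (suc r)) t)

    positive : Tree (suc (height l (suc r))) P (λ y → Q y × R x y ≡ true) →
      Ladder true (suc l) P Q ⊎ Ladder false (suc r) P Q
    positive (y , (qy , rxy) , kids) =
      Sum.map (Ladder-∷ px qy rxy) (Ladder-mono proj₁ proj₁) (tree⇒ladder l (suc r) (kids false))

    negative : Tree (suc (height (suc l) r)) P (λ y → Q y × R x y ≡ false) →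
      Ladder true (suc l) P Q ⊎ Ladder false (suc r) P Q
    negative (y , (qy , rxy) , kids) =
      Sum.map (Ladder-mono proj₁ proj₁) (Ladder-∷ px qy rxy) (tree⇒ladder (suc l) r (kids true))

  -- Reversing both index orders turns the relation `j < i` into `i < j`. Dropping the first `a` and
  -- the last `b` shifts the indices by one, which turns `i < j` into `i ≤ j`. The lost rung
  -- explains the `suc k` in `ladder`.
  reverse : ∀ {k} {P : Pred X 0ℓ} {Q : Pred Y 0ℓ} → Ladder false (suc k) P Q → Ladder true k P Q
  reverse {k} L = record
    { a     = a L ∘ suc ∘ opposite
    ; b     = b L ∘ inject₁ ∘ opposite
    ; a∈P   = λ i → a∈P L _
    ; b∈Q   = λ j → b∈Q L _
    ; above = λ i j i≤j → below L _ _
        (subst (_< suc (toℕ (opposite i))) (sym (toℕ-inject₁ (opposite j))) (s≤s (opposite-antitone i j i≤j)))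
    ; below = λ i j j<i → above L _ _
        (subst (suc (toℕ (opposite i)) ≤_) (sym (toℕ-inject₁ (opposite j))) (opposite-strict j i j<i))
    }
    where
    opposite-antitone : ∀ (i j : Fin k) → i ≤ᶠ j → opposite j ≤ᶠ opposite i
    opposite-antitone i j i≤j rewrite opposite-prop i | opposite-prop j = ∸-monoʳ-≤ k (s≤s i≤j)
    opposite-strict : ∀ (i j : Fin k) → i <ᶠ j → opposite j <ᶠ opposite i
    opposite-strict i j i<j rewrite opposite-prop i | opposite-prop j = ∸-monoʳ-< (s≤s i<j) (toℕ<n j)

  ladder : ∀ k {P : Pred X 0ℓ} {Q : Pred Y 0ℓ} → Tree (height k (suc k)) P Q → Ladder true k P Q
  ladder k t with tree⇒ladder k (suc k) t
  ... | inj₁ L = L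
  ... | inj₂ L = reverse L

-- Separated families and packing

greedy-net : ∀ {X : Set} {_~_ : X → X → Set} → (∀ x z → Dec (x ~ z)) → (∀ x → x ~ x) → (xs : List X) →
  Σ (List X) λ L → AllPairs (λ x z → ¬ (x ~ z)) L × (∀ {x} → x ∈ᴸ xs → Any (x ~_) L)
greedy-net _~?_ ~-refl [] = [] , [] , λ ()
greedy-net _~?_ ~-refl (x ∷ xs) with greedy-net _~?_ ~-refl xs
... | L , apart , near with Any.any? (x ~?_) L
...   | yes x~L = L , apart , λ { (here refl) → x~L ; (there z∈xs) → near z∈xs }
...   | no  x≁L = x ∷ L , ¬Any⇒All¬ L x≁L ∷ apart ,
                  λ { (here refl) → here (~-refl x) ; (there z∈xs) → there (near z∈xs) }

xor-triangle : ∀ a b c → 𝟙 (a xor b) ≤ 𝟙 (a xor c) + 𝟙 (c xor b)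
xor-triangle true  true  c     = z≤n
xor-triangle false false c     = z≤n
xor-triangle true  false true  = ≤-refl
xor-triangle true  false false = ≤-refl
xor-triangle false true  true  = ≤-refl
xor-triangle false true  false = ≤-refl

module Packing {X : Set} {n : ℕ} (R : X → Fin n → Bool) where
  open Trees R

  -- `p` ranges over all patterns, not only rows of `R`, because `splitting-point` measures
  -- distances to a majority pattern.
  distTo : X → (Fin n → Bool) → ℕ
  distTo x p = # (λ y → R x y xor p y)

  dist : X → X → ℕ
  dist x z = distTo x (R z)

  dist≤distTo : ∀ x z p → dist x z ≤ distTo x p + distTo z p
  dist≤distTo x z p = begin
    dist x z
      ≤⟨ sum-mono (λ y → xor-triangle (R x y) (R z y) (p y)) ⟩
    sum (λ y → 𝟙 (R x y xor p y) + 𝟙 (p y xor R z y))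
      ≡⟨ ∑-distrib-+ (λ y → 𝟙 (R x y xor p y)) _ ⟩
    distTo x p + # (λ y → p y xor R z y)
      ≡⟨ cong (distTo x p +_) (#-cong λ y → xor-comm (p y) (R z y)) ⟩
    distTo x p + distTo z p ∎
    where open ≤-Reasoning

  dist-self : ∀ x → dist x x ≡ 0
  dist-self x = trans (#-cong λ y → xor-same (R x y)) (#-none n)

  dist-sym : ∀ x z → dist x z ≡ dist z x
  dist-sym x z = #-cong λ y → xor-comm (R x y) (R z y)

  side : List X → Fin n → Bool → List X
  side L y s = filter (λ x → R x y ≟ᵇ s) L

  -- Double counting of the pairs of a list member and a point `y` at which it disagrees with `p`.
  sum-distTo : ∀ p L → sumᴸ (List.map (λ x → distTo x p) L) ≡ sum (λ y → length (side L y (not (p y))))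
  sum-distTo p []      = sym (#-none n)
  sum-distTo p (x ∷ L) = begin
    distTo x p + sumᴸ (List.map (λ x → distTo x p) L)
      ≡⟨ cong (distTo x p +_) (sum-distTo p L) ⟩
    distTo x p + sum (λ y → length (side L y (not (p y))))
      ≡⟨ ∑-distrib-+ (λ y → 𝟙 (R x y xor p y)) _ ⟨
    sum (λ y → 𝟙 (R x y xor p y) + length (side L y (not (p y))))
      ≡⟨ sum-cong-≗ step ⟩
    sum (λ y → length (side (x ∷ L) y (not (p y)))) ∎
    where
    open ≡-Reasoning
    step : ∀ y → 𝟙 (R x y xor p y) + length (side L y (not (p y))) ≡ length (side (x ∷ L) y (not (p y)))
    step y with R x y | p y
    ... | true  | true  = refl
    ... | true  | false = refl
    ... | false | true  = refl
    ... | false | false = refl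

  Apart : ℕ → X → X → Set
  Apart P x z = ¬ (P * dist x z ≤ n)

  -- Take the members two at a time: by the triangle inequality, the distances of an apart pair to
  -- `p` add up to more than `n / P`. The summand `n` pays for a member left over.
  apart-bound : ∀ {P} p L → AllPairs (Apart P) L →
    n * length L ≤ n + 2 * (P * sumᴸ (List.map (λ x → distTo x p) L))
  apart-bound p []      _ = ≤-trans (≤-reflexive (*-zeroʳ n)) z≤n
  apart-bound p (x ∷ []) _ = ≤-trans (≤-reflexive (*-identityʳ n)) (m≤m+n n _)
  apart-bound {P} p (x ∷ z ∷ L) ((x≁z ∷ _) ∷ _ ∷ apart) = begin
    n * (2 + length L)                   ≡⟨ double n (length L) ⟩
    2 * n + n * length L                 ≤⟨ +-mono-≤ (*-monoʳ-≤ 2 n≤) (apart-bound {P} p L apart) ⟩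
    2 * (P * (δx + δz)) + (n + 2 * (P * S)) ≡⟨ regroup P δx δz n S ⟩
    n + 2 * (P * (δx + (δz + S)))        ∎
    where
    open ≤-Reasoning
    δx δz S : ℕ
    δx = distTo x p
    δz = distTo z p
    S = sumᴸ (List.map (λ x → distTo x p) L)
    double : ∀ n l → n * (2 + l) ≡ 2 * n + n * l
    double = solve-∀
    n≤ : n ≤ P * (δx + δz)
    n≤ = ≤-trans (<⇒≤ (≰⇒> x≁z)) (*-monoʳ-≤ P (dist≤distTo x z p))
    regroup : ∀ P a b n s → 2 * (P * (a + b)) + (n + 2 * (P * s)) ≡ n + 2 * (P * (a + (b + s)))
    regroup = solve-∀

  Splits : List X → ℕ → Fin n → Set
  Splits L c y = c ≤ length (side L y true) × c ≤ length (side L y false)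

  -- Otherwise every y has a majority value p y, and the members of L are on average close to p,
  -- hence close to each other.
  splitting-point : ∀ {P c L} → .{{NonZero n}} → AllPairs (Apart P) L → 1 ≤ c →
    (2 * P + 2) * c ≤ length L → Σ (Fin n) (Splits L c)
  splitting-point {P} {c} {L} apart 1≤c long
    with any? (λ y → (c ≤? length (side L y true)) ×-dec (c ≤? length (side L y false)))
  ... | yes found = found
  ... | no  none  = contradiction 2n≤n (<⇒≱ (m<m+n n (>-nonZero⁻¹ n)))
    where
    minority : ∀ y → Σ Bool λ s → length (side L y (not s)) ≤ c
    minority y with c ≤? length (side L y true) | c ≤? length (side L y false)
    ... | no  c≰ | _     = false , <⇒≤ (≰⇒> c≰)
    ... | yes _  | no c≰ = true , <⇒≤ (≰⇒> c≰)
    ... | yes c≤ | yes c≤′ = contradiction (y , c≤ , c≤′) none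
    p : Fin n → Bool
    p = proj₁ ∘ minority
    open ≤-Reasoning
    2n≤n : n + n ≤ n
    -- In `2 * P + 2` the part `2 * P` cancels against the total distance to `p`; the remaining 2
    -- leaves `2 * n` against `n`.
    2n≤n = +-cancelʳ-≤ (2 * (P * (n * c))) _ _ (begin
      n + n + 2 * (P * (n * c))     ≤⟨ +-monoˡ-≤ _ (+-mono-≤ (m≤m*n′ n) (m≤m*n′ n)) ⟩
      n * c + n * c + 2 * (P * (n * c)) ≡⟨ regroup n P c ⟩
      n * ((2 * P + 2) * c)         ≤⟨ *-monoʳ-≤ n long ⟩
      n * length L                  ≤⟨ apart-bound {P} p L apart ⟩
      n + 2 * (P * sumᴸ (List.map (λ x → distTo x p) L)) ≡⟨ cong (λ s → n + 2 * (P * s)) (sum-distTo p L) ⟩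
      n + 2 * (P * sum (λ y → length (side L y (not (p y)))))
        ≤⟨ +-monoʳ-≤ n (*-monoʳ-≤ 2 (*-monoʳ-≤ P (sum-bound (proj₂ ∘ minority)))) ⟩
      n + 2 * (P * (n * c)) ∎)
      where
      m≤m*n′ : ∀ m → m ≤ m * c
      m≤m*n′ m = ≤-trans (≤-reflexive (sym (*-identityʳ m))) (*-monoʳ-≤ m 1≤c)
      regroup : ∀ n P c → n * c + n * c + 2 * (P * (n * c)) ≡ n * ((2 * P + 2) * c)
      regroup = solve-∀

  -- Each level costs a factor `2 * P + 2`: `splitting-point` leaves that share of the list on
  -- either side, and a sublist of an apart list is apart.
  packing : ∀ {P} k L → .{{NonZero n}} → AllPairs (Apart P) L → (2 * P + 2) ^ k ≤ length L →
    Tree k (_∈ᴸ L) (λ _ → ⊤)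
  packing zero    (x ∷ L) apart long = x , here refl
  packing {P} (suc k) L apart long
    with y , c≤ , c≤′ ← splitting-point {P} apart
           (m^n>0 (2 * P + 2) {{>-nonZero (m≤n⇒m≤o+n (2 * P) (s≤s z≤n))}} k) long
    = y , tt , kids
    where
    kid : ∀ s → (2 * P + 2) ^ k ≤ length (side L y s) → Tree k (λ x → x ∈ᴸ L × R x y ≡ s) (λ _ → ⊤)
    kid s c≤ = Tree-mono k (∈-filter⁻ (λ x → R x y ≟ᵇ s)) id
      (packing {P} k (side L y s) (AllPairs.filter⁺ (λ x → R x y ≟ᵇ s) apart) c≤)
    kids : ∀ s → Tree k (λ x → x ∈ᴸ L × R x y ≡ s) (λ _ → ⊤)
    kids true  = kid true c≤
    kids false = kid false c≤′

-- Booleans and the passage to rationals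

does-true : ∀ {S : Set} (d : Dec S) → does d ≡ true → S
does-true (yes s) _ = s

∨-false : ∀ {a b} → a ∨ b ≡ false → a ≡ false × b ≡ false
∨-false {false} {false} _ = refl , refl

xor-false : ∀ {a b} → a xor b ≡ false → a ≡ b
xor-false {false} {false} _ = refl
xor-false {true}  {true}  _ = refl

#-∨ : ∀ {n} (p q : Fin n → Bool) → # (λ i → p i ∨ q i) ≤ # p + # q
#-∨ p q = ≤-trans (sum-mono λ i → 𝟙-∨ (p i) (q i)) (≤-reflexive (∑-distrib-+ (𝟙 ∘ p) (𝟙 ∘ q)))
  where
  𝟙-∨ : ∀ a b → 𝟙 (a ∨ b) ≤ 𝟙 a + 𝟙 b
  𝟙-∨ true  b = s≤s z≤n
  𝟙-∨ false b = ≤-refl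

-- A positive rational is at least one over its denominator, so `ε` enters the argument only through
-- `↧ₙ ε`.
toℚ-bound : ∀ ε → 0ℚ <ℚ ε → ∀ a b → ℚ.↧ₙ ε * a ≤ b → toℚ a ≤ℚ ε *ℚ toℚ b
toℚ-bound (mkℚ (ℤ.+ zero) _ _) (ℚ.*<* (ℤ.+<+ ()))
toℚ-bound (mkℚ ℤ.-[1+ _ ] _ _) (ℚ.*<* ())
toℚ-bound ε@(mkℚ ℤ.+[1+ p ] q-1 _) _ a b qa≤b = ℚ.toℚᵘ-cancel-≤ (begin
  toℚᵘ (toℚ a)                ≃⟨ ℚ.toℚᵘ-fromℚᵘ (mkℚᵘ (ℤ.+ a) 0) ⟩
  mkℚᵘ (ℤ.+ a) 0              ≤⟨ *≤* cross ⟩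
  toℚᵘ ε ℚᵘ.* mkℚᵘ (ℤ.+ b) 0  ≃⟨ ℚᵘ.*-congˡ {toℚᵘ ε} (ℚ.toℚᵘ-fromℚᵘ (mkℚᵘ (ℤ.+ b) 0)) ⟨
  toℚᵘ ε ℚᵘ.* toℚᵘ (toℚ b)    ≃⟨ ℚ.toℚᵘ-homo-* ε (toℚ b) ⟨
  toℚᵘ (ε *ℚ toℚ b)           ∎)
  where
  open ℚᵘ.≤-Reasoning
  natural : a * (suc q-1 * 1) ≤ suc p * b * 1
  natural = ≤-trans (≤-reflexive (trans (cong (a *_) (*-identityʳ (suc q-1))) (*-comm a (suc q-1))))
    (≤-trans qa≤b (≤-trans (m≤m+n b (p * b)) (≤-reflexive (sym (*-identityʳ (suc p * b))))))
  cross : ℤ.+ a ℤ.* ℤ.+ (suc q-1 * 1) ℤ.≤ (ℤ.+[1+ p ] ℤ.* ℤ.+ b) ℤ.* ℤ.+ 1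
  cross = subst₂ ℤ._≤_ (ℤ.pos-* a (suc q-1 * 1))
    (trans (ℤ.pos-* (suc p * b) 1) (cong (ℤ._* ℤ.+ 1) (ℤ.pos-* (suc p) b))) (ℤ.+≤+ natural)

∧-true : ∀ {a b} → a ∧ b ≡ true → a ≡ true × b ≡ true
∧-true {true} {true} _ = refl , refl

-- Constants

net : ℕ → ℕ → ℕ
net k P = (2 * P + 2) ^ k

-- The number of self-maps of a net with `net k P` members; see `code`.
index : ℕ → ℕ → ℕ
index k P = net k P ^ net k P

-- The first summand serves `regular`, the second `close-trans`.
finer : ℕ → ℕ → ℕ → ℕ
finer k q P = q * index k P + 2 * P

-- Which of the `n` candidate scales is good depends on the group, so the index bounds of all of
-- them are added up.
bound : ℕ → ℕ → ℕ → ℕ → ℕ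
bound k q zero    P = 0
bound k q (suc n) P = index k P + bound k q n (4 * finer k q P)

-- Translates of a subset and their distances

module Translates (G : FinGroup) (A : Subset (FinGroup.order G)) where
  open FinGroup G
  open IsGroup isGroup using (assoc; identityˡ; identityʳ; inverseʳ)

  private
    C : Set
    C = Fin order

  instance
    order-nonZero : NonZero order
    order-nonZero = nonZero e
      where
      nonZero : ∀ {n} → Fin n → NonZero n
      nonZero {suc n} _ = _

  group : Group 0ℓ 0ℓ
  group = record { isGroup = isGroup }

  open GroupProperties group using (\\-leftDividesˡ; \\-leftDividesʳ; //-rightDividesˡ; //-rightDividesʳ)

  #-translateˡ : ∀ g (p : C → Bool) → # (λ x → p (g ∙ x)) ≡ # p
  #-translateˡ g p = #-permute p
    (permutation (g ∙_) ((g ⁻¹) ∙_) (\\-leftDividesˡ g) (\\-leftDividesʳ g))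

  #-translateʳ : ∀ g (p : C → Bool) → # (λ x → p (x ∙ g)) ≡ # p
  #-translateʳ g p = #-permute p
    (permutation (_∙ g) (_∙ (g ⁻¹)) (//-rightDividesˡ g) (//-rightDividesʳ g))

  R : C → C → Bool
  R x y = lookup A (x ∙ y)

  open Trees R
  open Packing R

  Stable⇒¬Tree : ∀ k → Stable G k A → ¬ Tree (height k (suc k)) (λ _ → ⊤) (λ _ → ⊤)
  Stable⇒¬Tree k stable t = stable (a , b , λ i j → mk⇔ (to i j) (λ i≤j → lookup⇒[]= _ A (above i j i≤j)))
    where
    open Ladder (ladder k t)
    to : ∀ i j → (a i ∙ b j) ∈ A → i ≤ᶠ j
    to i j ∈A = ≮⇒≥ λ j<i → contradiction (trans (sym ([]=⇒lookup ∈A)) (below i j j<i)) λ ()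

  -- Left multiplication by `g` permutes the points `y` being counted.
  dist-translate : ∀ x z g → dist (x ∙ g) (z ∙ g) ≡ dist x z
  dist-translate x z g = trans
    (#-cong λ y → cong₂ (λ u v → lookup A u xor lookup A v) (assoc x g y) (assoc z g y))
    (#-translateˡ g (λ y → R x y xor R z y))

  Close : ℕ → C → C → Set
  Close P x z = P * dist x z ≤ order

  close? : ∀ P x z → Dec (Close P x z)
  close? P x z = P * dist x z ≤? order

  close-refl : ∀ P x → Close P x x
  close-refl P x rewrite dist-self x | *-zeroʳ P = z≤n

  close-sym : ∀ {P} x z → Close P x z → Close P z x
  close-sym {P} x z = subst (λ d → P * d ≤ order) (dist-sym x z)

  close-translate : ∀ {P} x z g → Close P x z → Close P (x ∙ g) (z ∙ g)
  close-translate {P} x z g = subst (λ d → P * d ≤ order) (sym (dist-translate x z g))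

  -- Finding a scale with a gap in the distances to `e`

  Good : ℕ → ℕ → Set
  Good P F = ∀ x → Close P x e → Close F x e

  -- The leaves agree with g outside a small set B, so that trees at g and x ∙ g can be joined at any y outside
  -- both exceptional sets where g and x ∙ g differ.
  Forest : ℕ → ℕ → Set
  Forest n P = ∀ g → Σ (C → Bool) λ B → P * # B ≤ 2 * order ×
    Tree n (λ z → ∀ y → B y ≡ false → R z y ≡ R g y) (λ _ → ⊤)

  forest-zero : ∀ P → Forest 0 P
  forest-zero P g = (λ _ → false) , small , g , λ _ _ → refl
    where
    small : P * # {order} (λ _ → false) ≤ 2 * order
    small rewrite #-none order | *-zeroʳ P = z≤n

  -- The elements `g` and `x ∙ g` differ exactly on `D`, whose size is `dist x e`. A point of `D`
  -- outside both exceptional sets separates the leaves of the two given trees and becomes the root.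
  forest-suc : ∀ {n P F} x → Close P x e → ¬ Close F x e → Forest n (4 * F) → Forest (suc n) P
  forest-suc {n} {P} {F} x close far forest g
    with B₀ , small₀ , t₀ ← forest g | B₁ , small₁ , t₁ ← forest (x ∙ g)
    = B , small , split (#-witness (λ y → B₀ y ∨ B₁ y) D B₀₁<D)
    where
    D B : C → Bool
    D y = R (x ∙ g) y xor R g y
    B y = D y ∨ (B₀ y ∨ B₁ y)

    #D : # D ≡ dist x e
    #D = trans (cong (dist (x ∙ g)) (sym (identityˡ g))) (dist-translate x e g)

    -- At scale `4 * F` either exceptional set has at most `order / (2 * F)` points, and `D` has
    -- more than `order / F`.
    B₀₁<D : # (λ y → B₀ y ∨ B₁ y) < # D
    B₀₁<D = *-cancelˡ-< F _ _ (begin-strict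
      F * # (λ y → B₀ y ∨ B₁ y) ≤⟨ *-monoʳ-≤ F (#-∨ B₀ B₁) ⟩
      F * (# B₀ + # B₁)         ≤⟨ *-cancelˡ-≤ 4 quarter ⟩
      order                     <⟨ ≰⇒> far ⟩
      F * dist x e              ≡⟨ cong (F *_) #D ⟨
      F * # D                   ∎)
      where
      open ≤-Reasoning
      expand : ∀ F a b → 4 * (F * (a + b)) ≡ 4 * F * a + 4 * F * b
      expand = solve-∀
      collect : ∀ n → 2 * n + 2 * n ≡ 4 * n
      collect = solve-∀
      quarter : 4 * (F * (# B₀ + # B₁)) ≤ 4 * order
      quarter = begin
        4 * (F * (# B₀ + # B₁))         ≡⟨ expand F (# B₀) (# B₁) ⟩
        4 * F * # B₀ + 4 * F * # B₁     ≤⟨ +-mono-≤ small₀ small₁ ⟩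
        2 * order + 2 * order           ≡⟨ collect order ⟩
        4 * order                       ∎

    -- By `B₀₁<D` the set `B` has at most twice as many points as `D`; this is the 2 in `Forest`.
    small : P * # B ≤ 2 * order
    small = begin
      P * # B                                 ≤⟨ *-monoʳ-≤ P (#-∨ D (λ y → B₀ y ∨ B₁ y)) ⟩
      P * (# D + # (λ y → B₀ y ∨ B₁ y))       ≤⟨ *-monoʳ-≤ P (+-monoʳ-≤ (# D) (<⇒≤ B₀₁<D)) ⟩
      P * (# D + # D)                         ≡⟨ double P (# D) ⟩
      2 * (P * # D)                           ≡⟨ cong (λ d → 2 * (P * d)) #D ⟩
      2 * (P * dist x e)                      ≤⟨ *-monoʳ-≤ 2 close ⟩
      2 * order                               ∎
      where
      open ≤-Reasoning
      double : ∀ P d → P * (d + d) ≡ 2 * (P * d)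
      double = solve-∀

    other : ∀ {a b s} → a xor b ≡ true → b ≢ s → a ≡ s
    other {true}  {false} {true}  _ _   = refl
    other {true}  {false} {false} _ b≢s = contradiction refl b≢s
    other {false} {true}  {true}  _ b≢s = contradiction refl b≢s
    other {false} {true}  {false} _ _   = refl

    Off : C → Set
    Off z = ∀ y → B y ≡ false → R z y ≡ R g y

    module Split {y} (dy : D y ≡ true) (by : B₀ y ∨ B₁ y ≡ false) where
      agree₀ : ∀ {s z} → R g y ≡ s → (∀ y′ → B₀ y′ ≡ false → R z y′ ≡ R g y′) → Off z × R z y ≡ s
      agree₀ gy z~g =
        (λ y′ out → z~g y′ (proj₁ (∨-false (proj₂ (∨-false {D y′} out))))) ,
        trans (z~g y (proj₁ (∨-false by))) gy

      agree₁ : ∀ {s z} → R g y ≢ s → (∀ y′ → B₁ y′ ≡ false → R z y′ ≡ R (x ∙ g) y′) → Off z × R z y ≡ s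
      agree₁ gy≢s z~xg =
        (λ y′ out → trans (z~xg y′ (proj₂ (∨-false {B₀ y′} (proj₂ (∨-false {D y′} out)))))
                          (xor-false (proj₁ (∨-false {D y′} out)))) ,
        trans (z~xg y (proj₂ (∨-false {B₀ y} by))) (other dy gy≢s)

      kid : ∀ s → Tree n (λ z → Off z × R z y ≡ s) (λ _ → ⊤)
      -- The tree at `g` lies on the side of `R g y`, the tree at `x ∙ g` on the opposite one.
      kid s = case (R g y ≟ᵇ s) of λ where
        (yes gy)   → Tree-mono n (agree₀ gy) id t₀
        (no gy≢s)  → Tree-mono n (agree₁ gy≢s) id t₁

    split : Σ C (λ y → D y ≡ true × B₀ y ∨ B₁ y ≡ false) → Tree (suc n) Off (λ _ → ⊤)
    split (y , dy , by) = y , tt , Split.kid dy by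

  -- A failing scale yields an `x` for `forest-suc`, which adds a level to the forest built from the
  -- later scales; `n` failures in a row thus give height `n`.
  good-scale : ∀ k q n P → Forest n P ⊎ Σ ℕ λ P′ → Good P′ (finer k q P′) × index k P′ ≤ bound k q n P
  good-scale k q zero    P = inj₁ (forest-zero P)
  good-scale k q (suc n) P
    with any? (λ x → close? P x e ×-dec ¬? (close? (finer k q P) x e))
  ... | no none = inj₂ (P , (λ x c → decidable-stable (close? (finer k q P) x e) λ ¬c → none (x , c , ¬c)) ,
                        m≤m+n _ _)
  ... | yes (x , close , far) with good-scale k q n (4 * finer k q P)
  ...   | inj₂ (P′ , good , small) = inj₂ (P′ , good , m≤n⇒m≤o+n _ small)
  ...   | inj₁ forest = inj₁ (forest-suc {P = P} {F = finer k q P} x close far forest)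

  -- The normal core at a good scale

  module Scale {P F : ℕ} (2P≤F : 2 * P ≤ F) (good : Good P F) where

    -- Right invariance moves the gap from `e` to any point `z`.
    close-refine : ∀ x z → Close P x z → Close F x z
    close-refine x z c = subst₂ (Close F) (//-rightDividesˡ z x) (identityˡ z)
      (close-translate {F} _ _ z
        (good _ (subst (Close P (x ∙ (z ⁻¹))) (inverseʳ z) (close-translate {P} x z (z ⁻¹) c))))

    -- Both distances refine to at most `order / F`, so their sum stays within `order / P` since
    -- `2 * P ≤ F`. Hence `Close P` is an equivalence relation.
    close-trans : ∀ x w z → Close P x w → Close P w z → Close P x z
    close-trans x w z xw wz = *-cancelˡ-≤ 2 (begin
      2 * (P * dist x z)                  ≡⟨ *-assoc 2 P (dist x z) ⟨
      2 * P * dist x z                    ≤⟨ *-mono-≤ 2P≤F (dist≤distTo x z (R w)) ⟩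
      F * (dist x w + dist z w)           ≡⟨ *-distribˡ-+ F (dist x w) (dist z w) ⟩
      F * dist x w + F * dist z w         ≤⟨ +-mono-≤ (close-refine x w xw) (close-refine z w (close-sym {P} w z wz)) ⟩
      order + order                       ≡⟨ cong (λ m → order + m) (+-identityʳ order) ⟨
      2 * order                           ∎)
      where open ≤-Reasoning

    -- The normal core of the subgroup of all x with Close P x e.
    Core : C → Set
    Core x = ∀ g → Close P (g ∙ x) g

    core? : ∀ x → Dec (Core x)
    core? x = all? λ g → close? P (g ∙ x) g

    K : Subset order
    K = tabulate (λ x → does (core? x))

    ∈K⁺ : ∀ {x} → Core x → lookup K x ≡ true
    ∈K⁺ {x} core = trans (lookup∘tabulate _ x) (dec-true (core? x) core)

    ∈K⁻ : ∀ {x} → lookup K x ≡ true → Core x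
    ∈K⁻ {x} x∈K = does-true (core? x) (trans (sym (lookup∘tabulate _ x)) x∈K)

    core-e : Core e
    core-e g = subst (λ x → Close P x g) (sym (identityʳ g)) (close-refl P g)

    core-∙ : ∀ {x y} → Core x → Core y → Core (x ∙ y)
    core-∙ {x} {y} cx cy g = subst (λ z → Close P z g) (assoc g x y)
      (close-trans ((g ∙ x) ∙ y) (g ∙ x) g (cy (g ∙ x)) (cx g))

    core-⁻¹ : ∀ {x} → Core x → Core (x ⁻¹)
    core-⁻¹ {x} cx g = close-sym {P} g (g ∙ (x ⁻¹))
      (subst (λ z → Close P z (g ∙ (x ⁻¹))) (//-rightDividesˡ x g) (cx (g ∙ (x ⁻¹))))

    -- `Core` quantifies over all left factors, so `g` is absorbed into `g′`; right invariance
    -- removes `g ⁻¹`.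
    core-conj : ∀ g {h} → Core h → Core ((g ∙ h) ∙ (g ⁻¹))
    core-conj g {h} ch g′ = subst₂ (Close P)
      (trans (assoc _ _ _) (trans (assoc _ _ _) (cong (g′ ∙_) (sym (assoc _ _ _)))))
      (//-rightDividesʳ g g′)
      (close-translate {P} ((g′ ∙ g) ∙ h) (g′ ∙ g) (g ⁻¹) (ch (g′ ∙ g)))

    K-normal : IsNormalSubgroup G K
    K-normal = record
      { e∈H         = enter core-e
      ; ∙-closed    = λ x∈ y∈ → enter (core-∙ (leave x∈) (leave y∈))
      ; ⁻¹-closed   = λ x∈ → enter (core-⁻¹ (leave x∈))
      ; conj-closed = λ g h∈ → enter (core-conj g (leave h∈))
      }
      where
      enter : ∀ {x} → Core x → x ∈ K
      enter {x} core = lookup⇒[]= x K (∈K⁺ core)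
      leave : ∀ {x} → x ∈ K → Core x
      leave x∈K = ∈K⁻ ([]=⇒lookup x∈K)

    ∣K∣ : ℕ
    ∣K∣ = # (lookup K)

    -- The index of the core

    module Net (L : List C) (covers : ∀ x → Any (Close P x) L) where
      rep : C → Fin (length L)
      rep x = Any.index (covers x)

      close-rep : ∀ x → Close P x (List.lookup L (rep x))
      close-rep x = lookup-index (covers x)

      -- Right multiplication by `x` permutes the classes of `Close P`; this records it on
      -- representatives. `Core` is the kernel of that action.
      action : C → Fin (length L) → Fin (length L)
      action x i = rep (List.lookup L i ∙ x)

      code : C → Fin (length L ^ length L)
      code x = funToFin (action x)

      -- With `l` representing `g`, the elements `g ∙ x`, `l ∙ x`, `l ∙ y`, `g ∙ y` are successively
      -- close, the middle pair because the codes agree. Translating by `y ⁻¹` finishes.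
      code-injective : ∀ x y → code x ≡ code y → Core (x ∙ (y ⁻¹))
      code-injective x y eq g = subst₂ (Close P) (assoc g x (y ⁻¹)) (//-rightDividesʳ y g)
        (close-translate {P} (g ∙ x) (g ∙ y) (y ⁻¹)
          (close-trans _ (l ∙ x) _ (close-translate {P} g l x (close-rep g))
          (close-trans _ (l ∙ y) _ lx~ly
            (close-sym {P} (g ∙ y) (l ∙ y) (close-translate {P} g l y (close-rep g))))))
        where
        l : C
        l = List.lookup L (rep g)
        same : rep (l ∙ x) ≡ rep (l ∙ y)
        same = trans (sym (finToFun-funToFin (action x) (rep g)))
              (trans (cong (λ c → finToFun c (rep g)) eq) (finToFun-funToFin (action y) (rep g)))
        lx~ly : Close P (l ∙ x) (l ∙ y)
        lx~ly = close-trans _ _ _ (close-rep (l ∙ x))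
          (close-sym {P} (l ∙ y) _ (subst (λ i → Close P (l ∙ y) (List.lookup L i)) (sym same) (close-rep (l ∙ y))))

      -- A nonempty fibre lies in a right coset of `K`.
      fibre : ∀ c → # (λ x → does (code x ≟ᶠ c)) ≤ ∣K∣
      fibre c with any? (λ x → code x ≟ᶠ c)
      ... | no none = #-mono λ x hit → contradiction (x , does-true (code x ≟ᶠ c) hit) none
      ... | yes (y , refl) = ≤-trans (#-mono λ x hit → ∈K⁺ (code-injective x y (does-true (code x ≟ᶠ code y) hit)))
                                     (≤-reflexive (#-translateʳ (y ⁻¹) (lookup K)))

      order-bound : order ≤ length L ^ length L * ∣K∣
      order-bound = preimage-bound code ∣K∣ fibre

    -- A maximal separated list covers the group, and `packing` would turn a long one into a tree.
    K-index : ∀ k → ¬ Tree k (λ _ → ⊤) (λ _ → ⊤) → order ≤ index k P * ∣K∣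
    K-index k noTree with greedy-net (close? P) (close-refl P) (allFin order)
    ... | L , apart , near = ≤-trans (Net.order-bound L (λ x → near (∈-allFin x)))
                                     (*-monoˡ-≤ ∣K∣ (≤-trans (^-monoˡ-≤ (length L) len≤) (^-monoʳ-≤ (net k P) len≤)))
      where
      instance
        net-nonZero : NonZero (net k P)
        net-nonZero = m^n≢0 (2 * P + 2) k {{>-nonZero (m≤n⇒m≤o+n (2 * P) (s≤s z≤n))}}
      len≤ : length L ≤ net k P
      len≤ = ≮⇒≥ λ long → noTree (Tree-mono k _ id (packing {P} k L apart (<⇒≤ long)))

    -- Regularity on the cosets of the core

    module Coset (g : C) where
      inCoset : C → Bool
      inCoset x = lookup K ((g ⁻¹) ∙ x)

      -- `s` is the value of `A` to avoid: `part false` lies in `A`, `part true` outside, and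
      -- `part (lookup A y)` holds the points that differ from `y`.
      part : Bool → C → Bool
      part s x = inCoset x ∧ (lookup A x xor s)

      #coset : # inCoset ≡ ∣K∣
      #coset = #-translateˡ (g ⁻¹) (lookup K)

      moved : C → C → Bool
      moved h y = lookup K h ∧ (R h y xor R e y)

      -- Every point of the coset is `h ∙ y` for exactly one `h` in `K`, so counting points opposite
      -- to `y` is counting such `h`.
      part≤moved : ∀ y → inCoset y ≡ true → # (part (lookup A y)) ≤ # (λ h → moved h y)
      part≤moved y y∈ = ≤-trans (≤-reflexive (sym (#-translateʳ y (part (lookup A y))))) (#-mono shift)
        where
        -- This writes `h` as a conjugate by `g` of a quotient of two elements of `K`, so that
        -- normality puts `h` in `K`.
        quotient : ∀ h → (g ∙ (((g ⁻¹) ∙ (h ∙ y)) ∙ (((g ⁻¹) ∙ y) ⁻¹))) ∙ (g ⁻¹) ≡ h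
        quotient h = begin
          (g ∙ (((g ⁻¹) ∙ (h ∙ y)) ∙ (u ⁻¹))) ∙ (g ⁻¹)
            ≡⟨ cong (λ z → (g ∙ (z ∙ (u ⁻¹))) ∙ (g ⁻¹)) regroup ⟩
          (g ∙ ((((g ⁻¹) ∙ (h ∙ g)) ∙ u) ∙ (u ⁻¹))) ∙ (g ⁻¹)
            ≡⟨ cong (λ z → (g ∙ z) ∙ (g ⁻¹)) (//-rightDividesʳ u _) ⟩
          (g ∙ ((g ⁻¹) ∙ (h ∙ g))) ∙ (g ⁻¹)
            ≡⟨ cong (_∙ (g ⁻¹)) (\\-leftDividesˡ g (h ∙ g)) ⟩
          (h ∙ g) ∙ (g ⁻¹)
            ≡⟨ //-rightDividesʳ g h ⟩
          h ∎
          where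
          open ≡-Reasoning
          u : C
          u = (g ⁻¹) ∙ y
          regroup : (g ⁻¹) ∙ (h ∙ y) ≡ ((g ⁻¹) ∙ (h ∙ g)) ∙ u
          regroup = trans (cong (λ z → (g ⁻¹) ∙ (h ∙ z)) (sym (\\-leftDividesˡ g y)))
            (trans (cong ((g ⁻¹) ∙_) (sym (assoc h g u))) (sym (assoc (g ⁻¹) (h ∙ g) u)))

        shift : ∀ h → part (lookup A y) (h ∙ y) ≡ true → moved h y ≡ true
        shift h in-part with hy∈ , differ ← ∧-true in-part =
          cong₂ _∧_
            (∈K⁺ (subst Core (quotient h) (core-conj g (core-∙ (∈K⁻ hy∈) (core-⁻¹ (∈K⁻ y∈))))))
            (trans (cong (λ z → R h y xor lookup A z) (identityˡ y)) differ)

      moves : ℕ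
      moves = sum (λ h → # (moved h))

      -- Members of `K` are close to `e`, hence by `good` each moves at most `order / F` points.
      moves-upper : F * moves ≤ ∣K∣ * order
      moves-upper = begin
        F * moves                             ≡⟨ *-distribˡ-sum F (λ h → # (moved h)) ⟩
        sum (λ h → F * # (moved h))           ≤⟨ sum-mono each ⟩
        sum (λ h → 𝟙 (lookup K h) * order)    ≡⟨ *-distribʳ-sum order (𝟙 ∘ lookup K) ⟨
        ∣K∣ * order                           ∎
        where
        open ≤-Reasoning
        each : ∀ h → F * # (moved h) ≤ 𝟙 (lookup K h) * order
        each h with lookup K h in h∈K
        ... | true  = ≤-trans (good h (subst (λ x → Close P x e) (identityˡ h) (∈K⁻ h∈K e))) (m≤m+n order 0)
        ... | false = ≤-reflexive (trans (cong (F *_) (#-none order)) (*-zeroʳ F))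

      -- Count the same pairs by `y`, keeping only `y` in the coset. The strict inequality is kept
      -- as `suc ∣K∣`.
      moves-lower : ∀ q → (∀ s → ∣K∣ < q * # (part s)) → ∣K∣ * suc ∣K∣ ≤ q * moves
      moves-lower q large = begin
        ∣K∣ * suc ∣K∣                            ≡⟨ cong (_* suc ∣K∣) #coset ⟨
        # inCoset * suc ∣K∣                      ≡⟨ *-distribʳ-sum (suc ∣K∣) (𝟙 ∘ inCoset) ⟩
        sum (λ y → 𝟙 (inCoset y) * suc ∣K∣)      ≤⟨ sum-mono each ⟩
        sum (λ y → q * # (λ h → moved h y))      ≡⟨ *-distribˡ-sum q (λ y → # (λ h → moved h y)) ⟨
        q * sum (λ y → # (λ h → moved h y))      ≡⟨ cong (q *_) (∑-comm (λ y h → 𝟙 (moved h y))) ⟩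
        q * moves                                ∎
        where
        open ≤-Reasoning
        each : ∀ y → 𝟙 (inCoset y) * suc ∣K∣ ≤ q * # (λ h → moved h y)
        each y with inCoset y in y∈
        ... | true  = ≤-trans (≤-reflexive (+-identityʳ _))
                        (≤-trans (large (lookup A y)) (*-monoʳ-≤ q (part≤moved y y∈)))
        ... | false = z≤n

      regular : ∀ {i} q → order ≤ i * ∣K∣ → q * i ≤ F → Σ Bool λ s → q * # (part s) ≤ ∣K∣
      regular {i} q order≤ qi≤F with q * # (part true) ≤? ∣K∣ | q * # (part false) ≤? ∣K∣
      ... | yes small | _         = true , small
      ... | no _      | yes small = false , small
      ... | no large  | no large′ = contradiction order≤0 (<⇒≱ (>-nonZero⁻¹ order))
        where
        open ≤-Reasoning
        both : ∀ s → ∣K∣ < q * # (part s)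
        both true  = ≰⇒> large
        both false = ≰⇒> large′
        expand : ∀ i κ → i * (κ * suc κ) ≡ i * κ + κ * (i * κ)
        expand = solve-∀
        rotate : ∀ i q m → i * (q * m) ≡ q * i * m
        rotate = solve-∀
        order≤0 : order ≤ 0
        -- The two bounds on `moves` differ only by the surplus one in `suc ∣K∣`, which leaves
        -- `i * ∣K∣ ≤ 0`.
        order≤0 = ≤-trans order≤ (+-cancelʳ-≤ (∣K∣ * (i * ∣K∣)) (i * ∣K∣) 0 (begin
          i * ∣K∣ + ∣K∣ * (i * ∣K∣) ≡⟨ expand i ∣K∣ ⟨
          i * (∣K∣ * suc ∣K∣)       ≤⟨ *-monoʳ-≤ i (moves-lower q both) ⟩
          i * (q * moves)           ≡⟨ rotate i q moves ⟩
          q * i * moves             ≤⟨ *-monoˡ-≤ moves qi≤F ⟩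
          F * moves                 ≤⟨ moves-upper ⟩
          ∣K∣ * order               ≤⟨ *-monoʳ-≤ ∣K∣ order≤ ⟩
          ∣K∣ * (i * ∣K∣)           ∎))

      ∣coset∩A∣ : ∣ coset G g K ∩ A ∣ ≡ # (part false)
      ∣coset∩A∣ = trans (#-subset (coset G g K ∩ A)) (#-cong λ x →
        trans (lookup-zipWith _∧_ x (coset G g K) A)
              (cong₂ _∧_ (lookup∘tabulate _ x) (sym (xor-identityʳ (lookup A x)))))

      ∣coset∖A∣ : ∣ coset G g K ∩ ∁ A ∣ ≡ # (part true)
      ∣coset∖A∣ = trans (#-subset (coset G g K ∩ ∁ A)) (#-cong λ x →
        trans (lookup-zipWith _∧_ x (coset G g K) (∁ A))
              (cong₂ _∧_ (lookup∘tabulate _ x)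
                (trans (lookup-map x not A) (xor-comm true (lookup A x)))))

    K-regular : ∀ {i} ε → 0ℚ <ℚ ε → order ≤ i * ∣K∣ → ℚ.↧ₙ ε * i ≤ F → ∀ g →
      (toℚ ∣ coset G g K ∩ A ∣ ≤ℚ ε *ℚ toℚ ∣ K ∣) ⊎ (toℚ ∣ coset G g K ∩ ∁ A ∣ ≤ℚ ε *ℚ toℚ ∣ K ∣)
    K-regular ε ε>0 order≤ qi≤F g = few⇒regular (regular (ℚ.↧ₙ ε) order≤ qi≤F)
      where
      open Coset g
      few⇒regular : Σ Bool (λ s → ℚ.↧ₙ ε * # (part s) ≤ ∣K∣) →
        (toℚ ∣ coset G g K ∩ A ∣ ≤ℚ ε *ℚ toℚ ∣ K ∣) ⊎ (toℚ ∣ coset G g K ∩ ∁ A ∣ ≤ℚ ε *ℚ toℚ ∣ K ∣)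
      few⇒regular (false , few) = inj₁ (toℚ-bound ε ε>0 _ _
        (subst₂ (λ a κ → ℚ.↧ₙ ε * a ≤ κ) (sym ∣coset∩A∣) (sym (#-subset K)) few))
      few⇒regular (true , few) = inj₂ (toℚ-bound ε ε>0 _ _
        (subst₂ (λ a κ → ℚ.↧ₙ ε * a ≤ κ) (sym ∣coset∖A∣) (sym (#-subset K)) few))

  -- Assembling the theorem

  RegularSubgroup : ℚ → ℕ → Set
  RegularSubgroup ε n = Σ (Subset order) λ H → IsNormalSubgroup G H × order ≤ n * ∣ H ∣ × (∀ g →
    (toℚ ∣ coset G g H ∩ A ∣ ≤ℚ ε *ℚ toℚ ∣ H ∣) ⊎ (toℚ ∣ coset G g H ∩ ∁ A ∣ ≤ℚ ε *ℚ toℚ ∣ H ∣))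

  regular-subgroup : ∀ t ε → 0ℚ <ℚ ε → ¬ Tree t (λ _ → ⊤) (λ _ → ⊤) →
    RegularSubgroup ε (bound t (ℚ.↧ₙ ε) t 1)
  -- The first `t` limits nets through `packing`; the second is the number of scales tried, since
  -- failing at all of them would build a tree of height `t`.
  regular-subgroup t ε ε>0 noTree = [ tall , fromScale ]′ (good-scale t q t 1)
    where
    q : ℕ
    q = ℚ.↧ₙ ε

    tall : Forest t 1 → RegularSubgroup ε (bound t q t 1)
    tall forest = contradiction (Tree-mono t _ id (proj₂ (proj₂ (forest e)))) noTree

    fromScale : Σ ℕ (λ P → Good P (finer t q P) × index t P ≤ bound t q t 1) →
      RegularSubgroup ε (bound t q t 1)
    fromScale (P , good , small) =
      K , K-normal ,
      subst (λ κ → order ≤ bound t q t 1 * κ) (sym (#-subset K)) (≤-trans index≤ (*-monoˡ-≤ ∣K∣ small)) ,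
      K-regular ε ε>0 index≤ (m≤m+n (q * index t P) (2 * P))
      where
      open Scale {P} {finer t q P} (m≤n+m (2 * P) (q * index t P)) good
      index≤ : order ≤ index t P * ∣K∣
      index≤ = K-index t noTree

theorem1p2 : (k : ℕ) → 1 ≤ k → (ε : ℚ) → 0ℚ <ℚ ε →
    Σ ℕ λ n → (G : FinGroup) → (A : Subset (FinGroup.order G)) → Stable G k A →
    Σ (Subset (FinGroup.order G)) λ H → IsNormalSubgroup G H
    × FinGroup.order G ≤ n * ∣ H ∣
    × ((g : Fin (FinGroup.order G)) →
    (toℚ ∣ coset G g H ∩ A ∣ ≤ℚ ε *ℚ toℚ ∣ H ∣)
    ⊎ (toℚ ∣ coset G g H ∩ ∁ A ∣ ≤ℚ ε *ℚ toℚ ∣ H ∣))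
theorem1p2 k _ ε ε>0 = bound t (ℚ.↧ₙ ε) t 1 , λ G A stable →
  Translates.regular-subgroup G A t ε ε>0 (Translates.Stable⇒¬Tree G A k stable)
  where
  t : ℕ
  t = height k (suc k)
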